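{- For every $k\geq 2$, with $n=2^k$, every cancellation-free linear circuit that computes the $n\times n$ Sierpinski gasket matrix $S_k$ has size at least $\frac{1}{2}n\log_2 n$.
   Context: The Sierpinski gasket matrices are defined by $S_0=(1)$ and $S_{k+1}=\begin{pmatrix}S_k&0\\S_k&S_k\end{pmatrix}$ (a $2^k\times 2^k$ matrix over $\mathbb{F}_2$). A linear circuit over $\mathbb{F}_2$ with inputs $x_1,\ldots,x_n$ is a directed acyclic graph whose in-degree-0 nodes are the inputs and whose other nodes (gates) have in-degree 2 and compute the XOR of their two children; $n$ nodes are designated as outputs $y_1,\ldots,y_n$, and the circuit computes $A$ if $\mathbf{y}=A\mathbf{x}$ for all $\mathbf{x}\in\mathbb{F}_2^n$. The size is the number of gates. The value vector $\kappa(u)\in\mathbb{F}_2^n$ of a node $u$ has $\kappa(u)_i=1$ iff $x_i$ occurs in the parity computed at $u$. A linear circuit is cancellation-free if whenever there is a directed path from a node $w$ to a node $u$, $\kappa(u)\geq\kappa(w)$ coordinatewise. -}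

module Defs where

open import Algebra.Bundles using (CommutativeRing)
open import Data.Bool.Base as Bool using (Bool; true; false; _∧_; _xor_)
import Data.Bool.Properties as Boolₚ
open import Data.Fin.Base using (Fin; zero; suc; remQuot)
open import Data.Fin.Induction using (spo-wellFounded)
open import Data.Fin.Properties using (_≟_)
open import Data.Nat.Base using (ℕ; zero; suc; _^_)
open import Data.Product.Base using (_×_; _,_)
open import Data.Vec.Functional using (Vector; zipWith)
open import Data.Vec.Functional.Relation.Binary.Pointwise using (Pointwise)
open import Induction.WellFounded using (WellFounded; Acc; acc)
open import Relation.Binary.Construct.Closure.ReflexiveTransitive using (Star)
open import Relation.Binary.Construct.Closure.Transitive
  using (TransClosure; [_]; _∷_; accessible⁻) renaming (_++_ to _++⁺_)
open import Relation.Binary.Definitions using (Irreflexive)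
open import Relation.Binary.PropositionalEquality
open import Relation.Nullary.Decidable.Core using (does)
open import Relation.Nullary.Negation.Core using (¬_)

-- 𝔽₂ is carried by Bool, with _xor_ as addition and _∧_ as multiplication.

𝔽₂ : CommutativeRing _ _
𝔽₂ = Boolₚ.xor-∧-commutativeRing

open import Algebra.Properties.Semiring.Sum (CommutativeRing.semiring 𝔽₂)
  using (sum-syntax; sum-cong-≗; ∑-distrib-+; sum-replicate-zero)

Matrix : ℕ → Set
Matrix n = Vector (Vector Bool n) n

infixl 7 _·_ _*ᵥ_

_·_ : ∀ {n} → Vector Bool n → Vector Bool n → Bool
_·_ {n} v x = ∑[ j < n ] (v j ∧ x j)

_*ᵥ_ : ∀ {n} → Matrix n → Vector Bool n → Vector Bool n
(A *ᵥ x) i = A i · x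

unit : ∀ {n} → Fin n → Vector Bool n
unit i j = does (i ≟ j)

-- The Sierpinski gasket matrices.  Since 2 ^ suc k = 2 * 2 ^ k, remQuot splits
-- an index into its half (0 for the first 2 ^ k indices, 1 for the last 2 ^ k)
-- and its position within that half.

S : ∀ k → Matrix (2 ^ k)
S zero    _ _ = true
S (suc k) i j = block (remQuot {2} (2 ^ k) i) (remQuot {2} (2 ^ k) j)
  where
  block : Fin 2 × Fin (2 ^ k) → Fin 2 × Fin (2 ^ k) → Bool
  block (zero  , i′) (zero  , j′) = S k i′ j′
  block (zero  , _ ) (suc _ , _ ) = false
  block (suc _ , i′) (_     , j′) = S k i′ j′

data Node (n s : ℕ) : Set where
  input : Fin n → Node n s
  gate  : Fin s → Node n s

data Edge {n s} (left right : Fin s → Node n s) : Node n s → Node n s → Set where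
  leftEdge  : ∀ g → Edge left right (left g)  (gate g)
  rightEdge : ∀ g → Edge left right (right g) (gate g)

-- Linear circuits over 𝔽₂.  The two children of a gate are not required to be
-- distinct, and an output may be any node, including an input.  (A gate with
-- equal children computes 0, which cannot happen in a cancellation-free
-- circuit.)

record Circuit (n : ℕ) : Set where
  field
    size        : ℕ
    left right  : Fin size → Node n size
    acyclic     : ∀ u → ¬ TransClosure (Edge left right) u u
    output      : Fin n → Node n size

  infix 4 _⟶_ _⟶*_ _⟶⁺_

  _⟶_ _⟶*_ _⟶⁺_ : Node n size → Node n size → Set
  _⟶_  = Edge left right
  _⟶*_ = Star _⟶_
  _⟶⁺_ = TransClosure _⟶_

  private
    _⊏_ : Fin size → Fin size → Set
    g ⊏ h = gate g ⟶⁺ gate h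

    irrefl : Irreflexive _≡_ _⊏_
    irrefl refl = acyclic _

    ⊏-wellFounded : WellFounded _⊏_
    ⊏-wellFounded = spo-wellFounded record
      { isEquivalence = isEquivalence
      ; irrefl        = irrefl
      ; trans         = _++⁺_
      ; <-resp-≈      = resp₂ _⊏_
      }

    acc-input : ∀ i → Acc _⟶⁺_ (input i)
    acc-input i = acc λ p → noPath p refl
      where
      noPath : ∀ {u v} → u ⟶⁺ v → v ≡ input i → ∀ {A : Set} → A
      noPath [ leftEdge _ ]  ()
      noPath [ rightEdge _ ] ()
      noPath (_ ∷ p)         eq = noPath p eq

    acc-gate : ∀ {g} → Acc _⊏_ g → Acc _⟶⁺_ (gate g)
    acc-gate {g} (acc rs) = acc below
      where
      below : ∀ {u} → u ⟶⁺ gate g → Acc _⟶⁺_ u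
      below {input i} _ = acc-input i
      below {gate h}  p = acc-gate (rs p)

  ⟶-wellFounded : WellFounded _⟶_
  ⟶-wellFounded (input i) = accessible⁻ _⟶_ (acc-input i)
  ⟶-wellFounded (gate g)  = accessible⁻ _⟶_ (acc-gate (⊏-wellFounded g))

  module _ {B : Set} (leaf : Fin n → B) (_⊕_ : B → B → B) where

    private
      foldAcc : ∀ u → Acc _⟶_ u → B
      foldAcc (input i) _        = leaf i
      foldAcc (gate g)  (acc rs) =
        foldAcc (left g) (rs (leftEdge g)) ⊕ foldAcc (right g) (rs (rightEdge g))

      foldAcc-irrelevant : ∀ u (p q : Acc _⟶_ u) → foldAcc u p ≡ foldAcc u q
      foldAcc-irrelevant (input i) _        _        = refl
      foldAcc-irrelevant (gate g)  (acc rs) (acc ts) = cong₂ _⊕_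
        (foldAcc-irrelevant (left g)  (rs (leftEdge g))  (ts (leftEdge g)))
        (foldAcc-irrelevant (right g) (rs (rightEdge g)) (ts (rightEdge g)))

      foldAcc-gate : ∀ g (p : Acc _⟶_ (gate g)) →
        foldAcc (gate g) p
          ≡ foldAcc (left g) (⟶-wellFounded _) ⊕ foldAcc (right g) (⟶-wellFounded _)
      foldAcc-gate g (acc rs) = cong₂ _⊕_
        (foldAcc-irrelevant (left g) _ _) (foldAcc-irrelevant (right g) _ _)

    fold : Node n size → B
    fold u = foldAcc u (⟶-wellFounded u)

    fold-input : ∀ i → fold (input i) ≡ leaf i
    fold-input i = refl

    fold-gate : ∀ g → fold (gate g) ≡ fold (left g) ⊕ fold (right g)
    fold-gate g = foldAcc-gate g (⟶-wellFounded (gate g))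

  value : Vector Bool n → Node n size → Bool
  value x = fold x _xor_

  -- κ u is the coefficient vector of the parity computed at u: the symmetric
  -- difference of the sets of variables occurring at the children of u.
  -- See value≡κ·x below.

  κ : Node n size → Vector Bool n
  κ = fold unit (zipWith _xor_)

  CancellationFree : Set
  CancellationFree = ∀ {w u} → w ⟶* u → Pointwise Bool._≤_ (κ w) (κ u)

open Circuit public using (size; CancellationFree)

infix 4 _computes_

_computes_ : ∀ {n} → Circuit n → Matrix n → Set
C computes A = ∀ x i → value x (output i) ≡ (A *ᵥ x) i
  where open Circuit C

-- Adequacy of κ: the node u computes the parity of the x i with κ u i ≡ true.

unit·x : ∀ {n} (i : Fin n) (x : Vector Bool n) → unit i · x ≡ x i
unit·x {suc n} zero    x = trans
  (cong (x zero xor_) (sum-replicate-zero n)) (Boolₚ.xor-identityʳ (x zero))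
unit·x {suc n} (suc i) x = unit·x i (λ j → x (suc j))

value≡κ·x : ∀ {n} (C : Circuit n) (x : Vector Bool n) u →
            Circuit.value C x u ≡ Circuit.κ C u · x
value≡κ·x C x u = go u (⟶-wellFounded u)
  where
  open Circuit C
  open ≡-Reasoning

  go : ∀ u → Acc _⟶_ u → value x u ≡ κ u · x
  go (input i) _        = sym (unit·x i x)
  go (gate g)  (acc rs) = begin
    value x (gate g)
      ≡⟨ fold-gate x _xor_ g ⟩
    value x (left g) xor value x (right g)
      ≡⟨ cong₂ _xor_ (go (left g) (rs (leftEdge g))) (go (right g) (rs (rightEdge g))) ⟩
    (κ (left g) · x) xor (κ (right g) · x)
      ≡⟨ ∑-distrib-+ (λ j → κ (left g) j ∧ x j) (λ j → κ (right g) j ∧ x j) ⟨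
    sum-syntax _ (λ j → (κ (left g) j ∧ x j) xor (κ (right g) j ∧ x j))
      ≡⟨ sum-cong-≗ (λ j → Boolₚ.∧-distribʳ-xor (x j) (κ (left g) j) (κ (right g) j)) ⟨
    zipWith _xor_ (κ (left g)) (κ (right g)) · x
      ≡⟨ cong (_· x) (fold-gate unit (zipWith _xor_) g) ⟨
    κ (gate g) · x ∎

{-# OPTIONS --safe #-}
module Submission where

-- Let top u be the largest index of an input with a path to the node u.
-- Cancellation-freeness forces top (output i) = i, as S k is lower
-- unitriangular.  For each dyadic block of indices, split into halves L and R of
-- size m, at least m gates have one child with top in L and the other with top
-- in R: for x supported on L, the values of those children in L determine every
-- node with top in R, in particular the outputs in R; these outputs are again a
-- copy of some S j applied to x, so they determine x.  Each gate is counted for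
-- at most one block, so summing over all blocks gives ½ n log₂ n gates.

open import Defs
open import Data.Nat.Base using (ℕ; _≤_; _*_; _^_)
open import Data.Nat.Logarithm using (⌊log₂_⌋)

open import Algebra.Bundles using (CommutativeRing)
import Algebra.Properties.Group as Groupₚ
open import Algebra.Properties.Semiring.Sum (CommutativeRing.semiring 𝔽₂)
  using (sum; sum-cong-≗; sum-remove)
open import Data.Bool.Base as Bool using (Bool; true; false; _∧_; _xor_; if_then_else_)
import Data.Bool.Properties as Boolₚ
open import Data.Empty using (⊥-elim)
open import Data.Fin.Base using (Fin; zero; suc; toℕ; combine; funToFin; finToFun; punchIn)
import Data.Fin.Induction as Finᵢ
open import Data.Fin.Properties as Finₚ using (2↔Bool)
open import Data.List.Base using (List; []; _∷_; length; filter; allFin; lookup)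
open import Data.List.Membership.Propositional using (_∈_)
open import Data.List.Membership.Propositional.Properties using (∈-filter⁺; ∈-allFin)
open import Data.List.Properties using (length-tabulate)
open import Data.List.Relation.Unary.Any using (index)
open import Data.List.Relation.Unary.Any.Properties using (lookup-index)
open import Data.Nat.Base using (zero; suc; _+_; _<_; _⊔_; z≤n; s≤s)
open import Data.Nat.Logarithm using (⌊log₂[2^n]⌋≡n)
open import Data.Nat.Properties
open import Data.Nat.Tactic.RingSolver using (solve-∀)
open import Data.Product.Base using (∃; _×_; _,_; proj₁; proj₂)
open import Data.Sum.Base using (_⊎_; inj₁; inj₂)
open import Data.Vec.Functional using (Vector; zipWith)
open import Function.Base using (_∘_; id)
open import Function.Bundles using (Inverse)
open import Induction.WellFounded using (Acc; acc)
open import Relation.Binary.Construct.Closure.ReflexiveTransitive using (ε; _◅_; _◅◅_)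
open import Relation.Binary.PropositionalEquality
open import Relation.Nullary using (¬_; yes; no; does)
open import Relation.Nullary.Decidable using (_×-dec_; dec-true; dec-false)
open import Relation.Unary using (Pred; Decidable)
open import Relation.Unary.Properties using (∁?)

-- Counting bit vectors and splitting lists.

funToFin-cong : ∀ {m n} {f g : Fin m → Fin n} → f ≗ g → funToFin f ≡ funToFin g
funToFin-cong {zero}  f≗g = refl
funToFin-cong {suc m} f≗g = cong₂ combine (f≗g zero) (funToFin-cong (f≗g ∘ suc))

-- Pigeonhole: coding vectors as binary numerals turns `f` into an injection from `Fin (2 ^ m)` to
-- `Fin (2 ^ t)`, impossible if `t < m`. Injectivity is taken up to pointwise equality, so no
-- function extensionality is involved.
injective-bits⇒≤ : ∀ {m t} (f : Vector Bool m → Vector Bool t) →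
  (∀ {v w} → f v ≗ f w → v ≗ w) → m ≤ t
injective-bits⇒≤ {m} {t} f f-injective =
  ≮⇒≥ λ t<m → <⇒≱ (^-monoʳ-< 2 ≤-refl t<m) (Finₚ.injective⇒≤ {f = F} F-injective)
  where
  open Inverse 2↔Bool using (to; from; strictlyInverseˡ; strictlyInverseʳ)

  decode : Fin (2 ^ m) → Vector Bool m
  decode i = to ∘ finToFun i

  F : Fin (2 ^ m) → Fin (2 ^ t)
  F i = funToFin (from ∘ f (decode i))

  F-injective : ∀ {i j} → F i ≡ F j → i ≡ j
  F-injective {i} {j} eq = begin
    i                             ≡⟨ Finₚ.funToFin-finToFin {m} {2} i ⟨
    funToFin (finToFun {2} {m} i) ≡⟨ funToFin-cong digits≗ ⟩
    funToFin (finToFun {2} {m} j) ≡⟨ Finₚ.funToFin-finToFin {m} {2} j ⟩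
    j                             ∎
    where
    open ≡-Reasoning

    outputs≗ : f (decode i) ≗ f (decode j)
    outputs≗ l = begin
      f (decode i) l                ≡⟨ strictlyInverseˡ _ ⟨
      to (from (f (decode i) l))    ≡⟨ cong to (Finₚ.finToFun-funToFin (from ∘ f (decode i)) l) ⟨
      to (finToFun (F i) l)         ≡⟨ cong (λ z → to (finToFun z l)) eq ⟩
      to (finToFun (F j) l)         ≡⟨ cong to (Finₚ.finToFun-funToFin (from ∘ f (decode j)) l) ⟩
      to (from (f (decode j) l))    ≡⟨ strictlyInverseˡ _ ⟩
      f (decode j) l                ∎

    digits≗ : finToFun {2} {m} i ≗ finToFun j
    digits≗ l = begin
      finToFun i l             ≡⟨ strictlyInverseʳ _ ⟨
      from (to (finToFun i l)) ≡⟨ cong from (f-injective outputs≗ l) ⟩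
      from (to (finToFun j l)) ≡⟨ strictlyInverseʳ _ ⟩
      finToFun j l             ∎

length-filter-∁ : ∀ {A : Set} {P : A → Set} (P? : Decidable P) (xs : List A) →
  length (filter P? xs) + length (filter (∁? P?) xs) ≡ length xs
length-filter-∁ P? [] = refl
length-filter-∁ P? (x ∷ xs) with P? x
... | yes _ = cong suc (length-filter-∁ P? xs)
... | no  _ = trans (+-suc _ _) (cong suc (length-filter-∁ P? xs))

-- Linear algebra over 𝔽₂ and unitriangular matrices.

unit-true : ∀ {n} (i : Fin n) → unit i i ≡ true
unit-true i = dec-true (i Finₚ.≟ i) refl

unit-true⁻ : ∀ {n} {i j : Fin n} → unit i j ≡ true → i ≡ j
unit-true⁻ {i = i} {j} eq with yes i≡j ← i Finₚ.≟ j = i≡j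

·-unit : ∀ {n} (v : Vector Bool n) j → v · unit j ≡ v j
·-unit v j = trans (sum-cong-≗ λ i → Boolₚ.∧-comm (v i) (unit j i)) (unit·x j v)

sum-cancel : ∀ {n} (f g : Vector Bool n) i →
  (∀ j → j ≢ i → f j ≡ g j) → sum f ≡ sum g → f i ≡ g i
sum-cancel {suc n} f g i f≡g Σf≡Σg = ∙-cancelʳ _ (f i) (g i) (begin
  f i xor sum (f ∘ punchIn i) ≡⟨ sum-remove f ⟨
  sum f                       ≡⟨ Σf≡Σg ⟩
  sum g                       ≡⟨ sum-remove g ⟩
  g i xor sum (g ∘ punchIn i)
    ≡⟨ cong (g i xor_) (sum-cong-≗ λ j → f≡g _ (Finₚ.punchInᵢ≢i i j)) ⟨
  g i xor sum (f ∘ punchIn i) ∎)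
  where
  open ≡-Reasoning
  open Groupₚ (CommutativeRing.+-group 𝔽₂) using (∙-cancelʳ)

record Unitriangular {n} (A : Matrix n) : Set where
  field
    diagonal : ∀ i → A i i ≡ true
    lower    : ∀ i j → A i j ≡ true → toℕ j ≤ toℕ i

  -- In row `i`, terms right of the diagonal vanish and terms left of it agree by hypothesis.
  -- Cancelling them all leaves the diagonal terms, whose coefficient is 1.
  forward-substitution : ∀ {x y i} → (∀ j → toℕ j < toℕ i → x j ≡ y j) →
    A i · x ≡ A i · y → x i ≡ y i
  forward-substitution {x} {y} {i} x≡y Ax≡Ay = begin
    x i           ≡⟨ cong (_∧ x i) (diagonal i) ⟨
    A i i ∧ x i   ≡⟨ sum-cancel _ _ i terms≡ Ax≡Ay ⟩
    A i i ∧ y i   ≡⟨ cong (_∧ y i) (diagonal i) ⟩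
    y i           ∎
    where
    open ≡-Reasoning

    terms≡ : ∀ j → j ≢ i → A i j ∧ x j ≡ A i j ∧ y j
    terms≡ j j≢i with A i j in eq
    ... | false = refl
    ... | true  = x≡y j (≤∧≢⇒< (lower i j eq) (j≢i ∘ Finₚ.toℕ-injective))

-- Block structure of the Sierpinski matrices.

S-diagonal-block : ∀ k (b : Fin 2) i j → S (suc k) (combine b i) (combine b j) ≡ S k i j
S-diagonal-block k b i j
  rewrite Finₚ.remQuot-combine {2} {2 ^ k} b i | Finₚ.remQuot-combine {2} {2 ^ k} b j
  with b
... | zero     = refl
... | suc zero = refl

-- Used with `c = zero`: the lower left block repeats the upper left one, so on inputs supported on
-- L the outputs in R recompute those in L.
S-lower-block : ∀ k (b : Fin 1) (c : Fin 2) i j →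
  S (suc k) (combine (suc b) i) (combine c j) ≡ S k i j
S-lower-block k b c i j
  rewrite Finₚ.remQuot-combine {2} {2 ^ k} (suc b) i
  = cong (S k i ∘ proj₂) (Finₚ.remQuot-combine {2} {2 ^ k} c j)

S-upper-block : ∀ k (b : Fin 1) i j →
  S (suc k) (combine {2} zero i) (combine (suc b) j) ≡ false
S-upper-block k b i j
  rewrite Finₚ.remQuot-combine {2} {2 ^ k} zero i
        | Finₚ.remQuot-combine {2} {2 ^ k} (suc b) j
  = refl

S-unitriangular : ∀ k → Unitriangular (S k)
S-unitriangular k = record { diagonal = diagonal k ; lower = lower k }
  where
  diagonal : ∀ k i → S k i i ≡ true
  diagonal zero    i = refl
  diagonal (suc k) i with b , i′ , refl ← Finₚ.combine-surjective {2} {2 ^ k} i =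
    trans (S-diagonal-block k b i′ i′) (diagonal k i′)

  lower : ∀ k i j → S k i j ≡ true → toℕ j ≤ toℕ i

  same-block : ∀ k (b : Fin 2) i j →
    S (suc k) (combine b i) (combine b j) ≡ true → toℕ (combine b j) ≤ toℕ (combine b i)
  same-block k b i j Sij = begin
    toℕ (combine b j)      ≡⟨ Finₚ.toℕ-combine b j ⟩
    2 ^ k * toℕ b + toℕ j  ≤⟨ +-monoʳ-≤ _ (lower k i j
                                (trans (sym (S-diagonal-block k b i j)) Sij)) ⟩
    2 ^ k * toℕ b + toℕ i  ≡⟨ Finₚ.toℕ-combine b i ⟨
    toℕ (combine b i)      ∎
    where open ≤-Reasoning

  lower zero    zero zero _ = z≤n
  lower (suc k) i j Sij with Finₚ.combine-surjective {2} {2 ^ k} i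
                           | Finₚ.combine-surjective {2} {2 ^ k} j
  ... | zero , i′ , refl | suc c , j′ , refl with () ←
    trans (sym (S-upper-block k c i′ j′)) Sij
  ... | suc b , i′ , refl | zero , j′ , refl =
    <⇒≤ (Finₚ.combine-monoˡ-< {2} {i = zero} {j = suc b} j′ i′ (s≤s z≤n))
  ... | zero     , i′ , refl | zero     , j′ , refl = same-block k zero i′ j′ Sij
  ... | suc zero , i′ , refl | suc zero , j′ , refl = same-block k (suc zero) i′ j′ Sij

-- Extension of vectors by zero, and intervals of indices.

module _ {m n} (e : Fin m → Fin n) where

  extend : Vector Bool m → Vector Bool n
  extend w t with Finₚ.any? (λ i → t Finₚ.≟ e i)
  ... | yes (i , _) = w i
  ... | no  _       = false

  extend-image : (∀ {i j} → e i ≡ e j → i ≡ j) → ∀ w i → extend w (e i) ≡ w i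
  extend-image e-injective w i with Finₚ.any? (λ j → e i Finₚ.≟ e j)
  ... | yes (j , ei≡ej) = cong w (sym (e-injective ei≡ej))
  ... | no  ∄j          = ⊥-elim (∄j (i , refl))

  extend-outside : ∀ w {t} → (∀ i → t ≢ e i) → extend w t ≡ false
  extend-outside w {t} t∉e with Finₚ.any? (λ i → t Finₚ.≟ e i)
  ... | yes (i , t≡ei) = ⊥-elim (t∉e i t≡ei)
  ... | no  _          = refl

Interval : ℕ → ℕ → Pred ℕ _
Interval a m t = a ≤ t × t < a + m

interval? : ∀ a m → Decidable (Interval a m)
interval? a m t = (a ≤? t) ×-dec (t <? a + m)

-- The largest input index below a node.

module _ {n} (C : Circuit n) where
  open Circuit C hiding (size; CancellationFree)

  node-induction : (P : Node n (size C) → Set) → (∀ i → P (input i)) →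
    (∀ g → P (left g) → P (right g) → P (gate g)) → ∀ u → P u
  node-induction P P-input P-gate u = go u (⟶-wellFounded u)
    where
    go : ∀ u → Acc _⟶_ u → P u
    go (input i) _        = P-input i
    go (gate g)  (acc rs) = P-gate g (go _ (rs (leftEdge g))) (go _ (rs (rightEdge g)))

  -- Defined by paths rather than by `κ`, so inputs that cancel still count.
  top : Node n (size C) → ℕ
  top = fold toℕ _⊔_

  top-gate : ∀ g → top (gate g) ≡ top (left g) ⊔ top (right g)
  top-gate = fold-gate toℕ _⊔_

  top-left≤ : ∀ g → top (left g) ≤ top (gate g)
  top-left≤ g = ≤-trans (m≤m⊔n _ _) (≤-reflexive (sym (top-gate g)))

  top-right≤ : ∀ g → top (right g) ≤ top (gate g)
  top-right≤ g = ≤-trans (m≤n⊔m _ _) (≤-reflexive (sym (top-gate g)))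

  value-gate-cong : ∀ {x y} g → value x (left g) ≡ value y (left g) →
    value x (right g) ≡ value y (right g) → value x (gate g) ≡ value y (gate g)
  value-gate-cong {x} {y} g eqˡ eqʳ = begin
    value x (gate g)                       ≡⟨ fold-gate x _xor_ g ⟩
    value x (left g) xor value x (right g) ≡⟨ cong₂ _xor_ eqˡ eqʳ ⟩
    value y (left g) xor value y (right g) ≡⟨ fold-gate y _xor_ g ⟨
    value y (gate g)                       ∎
    where open ≡-Reasoning

  value-local : ∀ {x y} u → (∀ t → toℕ t ≤ top u → x t ≡ y t) → value x u ≡ value y u
  value-local {x} {y} = node-induction _ (λ i x≡y → x≡y i ≤-refl) λ g ihˡ ihʳ x≡y →
    value-gate-cong g (ihˡ λ t t≤ → x≡y t (≤-trans t≤ (top-left≤ g)))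
                      (ihʳ λ t t≤ → x≡y t (≤-trans t≤ (top-right≤ g)))

  -- Supplies an actual path to which cancellation-freeness can be applied.
  top-reached : ∀ u → ∃ λ i → toℕ i ≡ top u × input i ⟶* u
  top-reached = node-induction _ (λ i → i , refl , ε) step
    where
    step : ∀ g → (∃ λ i → toℕ i ≡ top (left g) × input i ⟶* left g) →
      (∃ λ i → toℕ i ≡ top (right g) × input i ⟶* right g) →
      ∃ λ i → toℕ i ≡ top (gate g) × input i ⟶* gate g
    step g (i , i≡ , i⟶*) (j , j≡ , j⟶*) with ⊔-sel (top (left g)) (top (right g))
    ... | inj₁ sel = i , trans i≡ (sym (trans (top-gate g) sel)) , i⟶* ◅◅ (leftEdge g ◅ ε)
    ... | inj₂ sel = j , trans j≡ (sym (trans (top-gate g) sel)) , j⟶* ◅◅ (rightEdge g ◅ ε)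

  κ≤top : ∀ u i → κ u i ≡ true → toℕ i ≤ top u
  κ≤top = node-induction _ (λ j i → ≤-reflexive ∘ cong toℕ ∘ sym ∘ unit-true⁻) step
    where
    step : ∀ g → (∀ i → κ (left g) i ≡ true → toℕ i ≤ top (left g)) →
      (∀ i → κ (right g) i ≡ true → toℕ i ≤ top (right g)) →
      ∀ i → κ (gate g) i ≡ true → toℕ i ≤ top (gate g)
    -- The third component rewrites `eq` as an equation about the XOR of the first two, which rules
    -- out the case where both are `false`.
    step g ihˡ ihʳ i eq with κ (left g) i in eqˡ
                           | κ (right g) i in eqʳ
                           | trans (sym (cong (λ v → v i) (fold-gate unit (zipWith _xor_) g))) eq
    ... | true  | _    | _ = ≤-trans (ihˡ i eqˡ) (top-left≤ g)
    ... | false | true | _ = ≤-trans (ihʳ i eqʳ) (top-right≤ g)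

  value-unit : ∀ u j → value (unit j) u ≡ κ u j
  value-unit u j = trans (value≡κ·x C (unit j) u) (·-unit (κ u) j)

  -- Gates crossing between two adjacent intervals.

  Crosses : ℕ → ℕ → Pred (Fin (size C)) _
  Crosses a m g =
      (Interval a m (top (left g)) × Interval (a + m) m (top (right g)))
    ⊎ (Interval a m (top (right g)) × Interval (a + m) m (top (left g)))

  -- Comparing `top` makes the choice total on gates; on a crossing gate it picks the child in the
  -- first interval.
  lowerChild : Fin (size C) → Node n (size C)
  lowerChild g = if does (top (left g) <? top (right g)) then left g else right g

  module _ {a m} {x y : Vector Bool n}
    (below   : ∀ t → toℕ t < a → x t ≡ y t)
    (above   : ∀ t → a + m ≤ toℕ t → x t ≡ y t)
    (crossed : ∀ g → Crosses a m g → value x (lowerChild g) ≡ value y (lowerChild g))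
    where

    private
      crossedˡ : ∀ g → Interval a m (top (left g)) → Interval (a + m) m (top (right g)) →
        value x (left g) ≡ value y (left g)
      crossedˡ g L R = subst (λ u → value x u ≡ value y u)
        (cong (if_then left g else right g) (dec-true (_ <? _) (<-≤-trans (proj₂ L) (proj₁ R))))
        (crossed g (inj₁ (L , R)))

      crossedʳ : ∀ g → Interval a m (top (right g)) → Interval (a + m) m (top (left g)) →
        value x (right g) ≡ value y (right g)
      crossedʳ g L R = subst (λ u → value x u ≡ value y u)
        (cong (if_then left g else right g)
          (dec-false (_ <? _) (≤⇒≯ (<⇒≤ (<-≤-trans (proj₂ L) (proj₁ R))))))
        (crossed g (inj₂ (L , R)))

      -- Treats one child `u` of a gate with sibling `v`. Either `top u` is in the second interval
      -- (induction), or it is below `a`, where the inputs agree, or it is in the first interval;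
      -- then `v` attains the maximum and the gate crosses.
      child : ∀ u v → Interval (a + m) m (top u ⊔ top v) →
        (Interval (a + m) m (top u) → value x u ≡ value y u) →
        (Interval a m (top u) → Interval (a + m) m (top v) → value x u ≡ value y u) →
        value x u ≡ value y u
      child u v (lo , hi) ih cross with a + m ≤? top u
      ... | yes a+m≤ = ih (a+m≤ , m⊔n<o⇒m<o _ _ hi)
      ... | no  a+m≰ with a ≤? top u
      ...   | no  a≰ = value-local u λ t t≤ → below t (≤-<-trans t≤ (≰⇒> a≰))
      ...   | yes a≤ = cross (a≤ , ≰⇒> a+m≰) (top-v≥ , m⊔n<o⇒n<o (top u) _ hi)
        where
        top-v≥ : a + m ≤ top v
        top-v≥ with ⊔-sel (top u) (top v)
        ... | inj₁ sel = ⊥-elim (a+m≰ (subst (a + m ≤_) sel lo))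
        ... | inj₂ sel = subst (a + m ≤_) sel lo

    -- Since `x` and `y` differ only on the first interval, a difference can enter the second one
    -- only through the lower child of a crossing gate, and there the values agree.
    crossed-determine : ∀ u → Interval (a + m) m (top u) → value x u ≡ value y u
    crossed-determine = node-induction _ (λ t → above t ∘ proj₁) λ g ihˡ ihʳ gate∈ →
      let both∈ = subst (Interval (a + m) m) (top-gate g) gate∈ in
      value-gate-cong g
        (child (left g) (right g) both∈ ihˡ (crossedˡ g))
        (child (right g) (left g) (subst (Interval (a + m) m) (⊔-comm (top (left g)) _) both∈)
          ihʳ (crossedʳ g))

  -- Cancellation-free circuits for unitriangular matrices.

  module _ (cancellationFree : CancellationFree C) {A : Matrix n}
    (unitriangular : Unitriangular A) (C-computes-A : C computes A) where
    open Unitriangular unitriangular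

    κ-output : ∀ i j → κ (output i) j ≡ A i j
    κ-output i j = begin
      κ (output i) j            ≡⟨ value-unit (output i) j ⟨
      value (unit j) (output i) ≡⟨ C-computes-A (unit j) i ⟩
      A i · unit j              ≡⟨ ·-unit (A i) j ⟩
      A i j                     ∎
      where open ≡-Reasoning

    -- The only use of cancellation-freeness: the input `t` attaining the maximum has a path to
    -- `output i`, so it survives in `κ (output i)`. Hence `A i t` is 1 and `t` is at most `i`. The
    -- nonzero diagonal entry gives the converse bound.
    top-output : ∀ i → top (output i) ≡ toℕ i
    top-output i = ≤-antisym top≤ (κ≤top (output i) i (trans (κ-output i i) (diagonal i)))
      where
      true≤ : ∀ {b c} → b Bool.≤ c → b ≡ true → c ≡ true
      true≤ Bool.b≤b eq = eq

      top≤ : top (output i) ≤ toℕ i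
      top≤ with t , t≡ , t⟶* ← top-reached (output i) = subst (_≤ toℕ i) t≡
        (lower i t (trans (sym (κ-output i t))
          (true≤ (cancellationFree t⟶* t) (unit-true t))))

    -- Feed `w` into L and zeros elsewhere, and record the lower child's value at each gate of `xs`.
    -- The record determines the outputs in R, hence the L rows of `A` applied to the input, and
    -- forward substitution recovers `w`. Extra gates in `xs` do no harm, so only completeness is
    -- required.
    crossings : ∀ {a m} (eᴸ eᴿ : Fin m → Fin n) →
      (∀ i → toℕ (eᴸ i) ≡ a + toℕ i) → (∀ i → toℕ (eᴿ i) ≡ a + m + toℕ i) →
      (∀ i j → A (eᴿ i) (eᴸ j) ≡ A (eᴸ i) (eᴸ j)) →
      ∀ xs → (∀ g → Crosses a m g → g ∈ xs) → m ≤ length xs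
    crossings {a} {m} eᴸ eᴿ toℕ-eᴸ toℕ-eᴿ A-rows xs xs-complete =
      injective-bits⇒≤ (λ w l → value (extend eᴸ w) (lowerChild (lookup xs l))) injective
      where
      open ≡-Reasoning

      eᴸ-injective : ∀ {i j} → eᴸ i ≡ eᴸ j → i ≡ j
      eᴸ-injective {i} {j} eq = Finₚ.toℕ-injective (+-cancelˡ-≡ a _ _
        (trans (sym (toℕ-eᴸ i)) (trans (cong toℕ eq) (toℕ-eᴸ j))))

      below : ∀ w {t} → toℕ t < a → extend eᴸ w t ≡ false
      below w t<a = extend-outside eᴸ w λ where
        i refl → m+n≮m a (toℕ i) (subst (_< a) (toℕ-eᴸ i) t<a)

      above : ∀ w {t} → a + m ≤ toℕ t → extend eᴸ w t ≡ false
      above w a+m≤ = extend-outside eᴸ w λ where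
        i refl → <⇒≱ (Finₚ.toℕ<n i) (+-cancelˡ-≤ a _ _ (subst (a + m ≤_) (toℕ-eᴸ i) a+m≤))

      -- `A-rows` controls only the columns in L; in the others the input is zero.
      row≡ : ∀ i w → A (eᴿ i) · extend eᴸ w ≡ A (eᴸ i) · extend eᴸ w
      row≡ i w = sum-cong-≗ term≡
        where
        term≡ : ∀ t → A (eᴿ i) t ∧ extend eᴸ w t ≡ A (eᴸ i) t ∧ extend eᴸ w t
        term≡ t with Finₚ.any? (λ j → t Finₚ.≟ eᴸ j)
        ... | yes (j , refl) = cong (_∧ w j) (A-rows i j)
        ... | no  _          = trans (Boolₚ.∧-zeroʳ (A (eᴿ i) t)) (sym (Boolₚ.∧-zeroʳ (A (eᴸ i) t)))

      injective : ∀ {v w} →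
        (∀ l → value (extend eᴸ v) (lowerChild (lookup xs l))
             ≡ value (extend eᴸ w) (lowerChild (lookup xs l))) → v ≗ w
      injective {v} {w} eq i = begin
        v i                ≡⟨ extend-image eᴸ eᴸ-injective v i ⟨
        extend eᴸ v (eᴸ i) ≡⟨ solve i (Finᵢ.<-wellFounded i) ⟩
        extend eᴸ w (eᴸ i) ≡⟨ extend-image eᴸ eᴸ-injective w i ⟩
        w i                ∎
        where
        crossed : ∀ g → Crosses a m g →
          value (extend eᴸ v) (lowerChild g) ≡ value (extend eᴸ w) (lowerChild g)
        crossed g g-crosses =
          subst (λ h → value (extend eᴸ v) (lowerChild h) ≡ value (extend eᴸ w) (lowerChild h))
            (sym (lookup-index g∈xs)) (eq (index g∈xs))
          where g∈xs = xs-complete g g-crosses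

        outputs≡ : ∀ i → value (extend eᴸ v) (output (eᴿ i)) ≡ value (extend eᴸ w) (output (eᴿ i))
        outputs≡ i = crossed-determine
          (λ t t<a → trans (below v t<a) (sym (below w t<a)))
          (λ t a+m≤ → trans (above v a+m≤) (sym (above w a+m≤)))
          crossed (output (eᴿ i))
          -- By `top-output`, the outputs indexed by R have their `top` in R.
          (subst (Interval (a + m) m) (sym (trans (top-output (eᴿ i)) (toℕ-eᴿ i)))
            (m≤m+n _ _ , +-monoʳ-< (a + m) (Finₚ.toℕ<n i)))

        rows≡ : ∀ i → A (eᴸ i) · extend eᴸ v ≡ A (eᴸ i) · extend eᴸ w
        rows≡ i = begin
          A (eᴸ i) · extend eᴸ v                 ≡⟨ row≡ i v ⟨
          A (eᴿ i) · extend eᴸ v                 ≡⟨ C-computes-A (extend eᴸ v) (eᴿ i) ⟨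
          value (extend eᴸ v) (output (eᴿ i))    ≡⟨ outputs≡ i ⟩
          value (extend eᴸ w) (output (eᴿ i))    ≡⟨ C-computes-A (extend eᴸ w) (eᴿ i) ⟩
          A (eᴿ i) · extend eᴸ w                 ≡⟨ row≡ i w ⟩
          A (eᴸ i) · extend eᴸ w                 ∎

        solve : ∀ i → Acc _ i → extend eᴸ v (eᴸ i) ≡ extend eᴸ w (eᴸ i)
        solve i (acc rs) = forward-substitution {extend eᴸ v} {extend eᴸ w} earlier (rows≡ i)
          where
          earlier : ∀ t → toℕ t < toℕ (eᴸ i) → extend eᴸ v t ≡ extend eᴸ w t
          earlier t t< with Finₚ.any? (λ j → t Finₚ.≟ eᴸ j)
          -- Off the block both extensions are `false`.
          ... | no  _          = refl
          ... | yes (j , refl) = begin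
            -- The match has unfolded the extensions; they are folded back to meet the induction
            -- hypothesis at `j`.
            v j                ≡⟨ extend-image eᴸ eᴸ-injective v j ⟨
            extend eᴸ v (eᴸ j) ≡⟨ solve j (rs (+-cancelˡ-< a _ _
                                    (subst₂ _<_ (toℕ-eᴸ j) (toℕ-eᴸ i) t<))) ⟩
            extend eᴸ w (eᴸ j) ≡⟨ extend-image eᴸ eᴸ-injective w j ⟩
            w j                ∎

    -- Recursion over the dyadic diagonal blocks.

    record DiagonalBlock (j a : ℕ) : Set where
      field
        -- Kept as data, so that halving a block is composition with `combine` and no bound on
        -- `a + 2 ^ j` has to be carried along.
        embed     : Fin (2 ^ j) → Fin n
        toℕ-embed : ∀ i → toℕ (embed i) ≡ a + toℕ i
        A-embed   : ∀ i i′ → A (embed i) (embed i′) ≡ S j i i′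

    open DiagonalBlock

    upperHalf : ∀ {j a} → DiagonalBlock (suc j) a → DiagonalBlock j a
    upperHalf {j} {a} D = record
      { embed     = embed D ∘ combine {2} zero
      ; toℕ-embed = λ i → trans (toℕ-embed D _) (cong (a +_) (trans
          (Finₚ.toℕ-combine {2} zero i) (cong (_+ toℕ i) (*-zeroʳ (2 ^ j)))))
      ; A-embed   = λ i i′ → trans (A-embed D _ _) (S-diagonal-block j zero i i′)
      }

    lowerHalf : ∀ {j a} → DiagonalBlock (suc j) a → DiagonalBlock j (a + 2 ^ j)
    lowerHalf {j} {a} D = record
      { embed     = embed D ∘ combine {2} (suc zero)
      ; toℕ-embed = λ i → trans (toℕ-embed D _) (trans (cong (a +_) (trans
          (Finₚ.toℕ-combine {2} (suc zero) i) (cong (_+ toℕ i) (*-identityʳ (2 ^ j)))))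
          (sym (+-assoc a _ _)))
      ; A-embed   = λ i i′ → trans (A-embed D _ _) (S-diagonal-block j (suc zero) i i′)
      }

    Within : ℕ → ℕ → Pred (Fin (size C)) _
    Within a m g = Interval a m (top (left g)) × Interval a m (top (right g))

    within? : ∀ a m → Decidable (Within a m)
    within? a m g = interval? a m (top (left g)) ×-dec interval? a m (top (right g))

    -- Two filters split `xs` into disjoint lists: gates within L, gates within R, and the rest,
    -- which contains the crossing gates. With `m = 2 ^ j`, the halves contribute `j * m` each and
    -- the crossings `2 * m`, since lengths are doubled; the sum is `suc j * (2 * m)`.
    diagonalBlock-bound : ∀ j {a} → DiagonalBlock j a → ∀ xs →
      (∀ g → Within a (2 ^ j) g → g ∈ xs) → j * 2 ^ j ≤ 2 * length xs
    diagonalBlock-bound zero    D xs complete = z≤n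
    diagonalBlock-bound (suc j) {a} D xs complete = begin
      suc j * (2 * m)                                ≡⟨ regroup j m ⟩
      j * m + (j * m + 2 * m)                        ≤⟨ +-mono-≤
        (diagonalBlock-bound j (upperHalf D) xsᴸ completeᴸ)
        (+-mono-≤ (diagonalBlock-bound j (lowerHalf D) xsᴿ completeᴿ)
          (*-monoʳ-≤ 2 (crossings (embed (upperHalf D)) (embed (lowerHalf D))
            (toℕ-embed (upperHalf D)) (toℕ-embed (lowerHalf D)) rows≡ xsˣ completeˣ))) ⟩
      2 * length xsᴸ + (2 * length xsᴿ + 2 * length xsˣ)
        ≡⟨ factor (length xsᴸ) (length xsᴿ) (length xsˣ) ⟩
      2 * (length xsᴸ + (length xsᴿ + length xsˣ))
        ≡⟨ cong (λ l → 2 * (length xsᴸ + l)) (length-filter-∁ (within? (a + m) m) rest) ⟩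
      2 * (length xsᴸ + length rest)
        ≡⟨ cong (2 *_) (length-filter-∁ (within? a m) xs) ⟩
      2 * length xs                                  ∎
      where
      open ≤-Reasoning

      m = 2 ^ j

      regroup : ∀ j m → suc j * (2 * m) ≡ j * m + (j * m + 2 * m)
      regroup = solve-∀

      factor : ∀ p q r → 2 * p + (2 * q + 2 * r) ≡ 2 * (p + (q + r))
      factor = solve-∀

      xsᴸ rest xsᴿ xsˣ : List (Fin (size C))
      xsᴸ  = filter (within? a m) xs
      rest = filter (∁? (within? a m)) xs
      xsᴿ  = filter (within? (a + m) m) rest
      xsˣ  = filter (∁? (within? (a + m) m)) rest

      double : a + m + m ≡ a + 2 * m
      double = trans (+-assoc a m m) (cong (λ z → a + (m + z)) (sym (+-identityʳ m)))

      fromᴸ : ∀ {t} → Interval a m t → Interval a (2 * m) t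
      fromᴸ (lo , hi) = lo , <-≤-trans hi (+-monoʳ-≤ a (m≤m+n m _))

      fromᴿ : ∀ {t} → Interval (a + m) m t → Interval a (2 * m) t
      fromᴿ {t} (lo , hi) = ≤-trans (m≤m+n a m) lo , subst (t <_) double hi

      disjoint : ∀ {t} → Interval a m t → ¬ Interval (a + m) m t
      disjoint (_ , hi) (lo , _) = <⇒≱ hi lo

      completeᴸ : ∀ g → Within a m g → g ∈ xsᴸ
      completeᴸ g w@(l , r) =
        ∈-filter⁺ (within? a m) (complete g (fromᴸ l , fromᴸ r)) w

      completeᴿ : ∀ g → Within (a + m) m g → g ∈ xsᴿ
      completeᴿ g w@(l , r) = ∈-filter⁺ (within? (a + m) m)
        (∈-filter⁺ (∁? (within? a m)) (complete g (fromᴿ l , fromᴿ r))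
          λ (l′ , _) → disjoint l′ l) w

      -- The children lie in different halves, so the gate is within neither and passes both
      -- complementary filters.
      completeˣ : ∀ g → Crosses a m g → g ∈ xsˣ
      completeˣ g (inj₁ (l , r)) = ∈-filter⁺ (∁? (within? (a + m) m))
        (∈-filter⁺ (∁? (within? a m)) (complete g (fromᴸ l , fromᴿ r))
          λ (_ , r′) → disjoint r′ r) λ (l′ , _) → disjoint l l′
      completeˣ g (inj₂ (r , l)) = ∈-filter⁺ (∁? (within? (a + m) m))
        (∈-filter⁺ (∁? (within? a m)) (complete g (fromᴿ l , fromᴸ r))
          λ (l′ , _) → disjoint l′ l) λ (_ , r′) → disjoint r r′

      rows≡ : ∀ i i′ →
        A (embed (lowerHalf D) i) (embed (upperHalf D) i′)
          ≡ A (embed (upperHalf D) i) (embed (upperHalf D) i′)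
      rows≡ i i′ = trans (A-embed D _ _)
        (trans (S-lower-block j zero zero i i′) (sym (A-embed (upperHalf D) i i′)))

theorem4 : ∀ (k : ℕ) → 2 ≤ k → (C : Circuit (2 ^ k)) →
    CancellationFree C → C computes S k →
    let n = 2 ^ k in n * ⌊log₂ n ⌋ ≤ 2 * size C
theorem4 k _ C cancellationFree C-computes-S = begin
  2 ^ k * ⌊log₂ 2 ^ k ⌋         ≡⟨ cong (2 ^ k *_) (⌊log₂[2^n]⌋≡n k) ⟩
  2 ^ k * k                     ≡⟨ *-comm (2 ^ k) k ⟩
  k * 2 ^ k                     ≤⟨ diagonalBlock-bound C cancellationFree (S-unitriangular k)
                                     C-computes-S k whole (allFin (size C)) (λ g _ → ∈-allFin g) ⟩
  2 * length (allFin (size C))  ≡⟨ cong (2 *_) (length-tabulate {n = size C} id) ⟩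
  2 * size C                    ∎
  where
  open ≤-Reasoning
  -- `S k` itself is the diagonal block of order `k` at offset 0.
  whole = record { embed = id ; toℕ-embed = λ _ → refl ; A-embed = λ _ _ → refl }
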